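{- Let $k\geq 3$ and $m\geq 1$ be integers, and let $\Phi$ be a first-order sentence (with equality) over binary relation symbols $R_1,\ldots,R_m$ that uses $k$ variables. Then there exist a first-order sentence $\Phi'$ (with equality) over a single binary relation symbol $E$ that uses the same number $k$ of variables, and integers $p,q$ with $p\geq 1$, such that $$\mathrm{Spec}(\Phi') = \{pn+q \mid n\in \mathrm{Spec}(\Phi)\}.$$ Moreover, every finite model of $\Phi'$ is an undirected bipartite graph.
   Context: The spectrum $\mathrm{Spec}(\varphi)$ of a first-order sentence $\varphi$ is the set of cardinalities of its finite models (structures have nonempty domain). A sentence uses $k$ variables if all variables occurring in it (free or bound) are among $k$ fixed variable symbols; variables may be re-quantified and reused. A model of a sentence over the single binary symbol $E$ is an undirected bipartite graph if $E$ is interpreted as a symmetric relation and the domain can be split into two disjoint parts such that every edge joins elements of different parts (so in particular there are no self-loops). -}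

module Defs where

open import Data.Bool using (Bool; T)
open import Data.Fin using (Fin; zero)
open import Data.Nat using (ℕ; _<_)
open import Data.Product using (_×_; ∃; ∃-syntax)
open import Data.Sum using (_⊎_)
open import Data.Vec.Functional using (Vector; updateAt)
open import Function using (const; _↔_)
open import Level using (Level; 0ℓ; _⊔_) renaming (suc to lsuc)
open import Relation.Binary.PropositionalEquality using (_≡_; _≢_)
open import Relation.Nullary using (¬_)
open import Relation.Unary using (Pred; _∈_)

infix  8 _≐′_
infix  7 ¬′_
infixr 6 _∧′_
infixr 5 _∨′_
infixr 4 _⇒′_

-- First-order formulas with equality over m binary relation symbols.
-- The only variable symbols are the k elements of Fin k; a quantifier names
-- the symbol it binds (no de Bruijn indices), so symbols can be re-quantified.
data Formula (m k : ℕ) : Set where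
  rel   : (R : Fin m) (x y : Fin k) → Formula m k
  _≐′_  : (x y : Fin k) → Formula m k
  ¬′_   : Formula m k → Formula m k
  _∧′_  : Formula m k → Formula m k → Formula m k
  _∨′_  : Formula m k → Formula m k → Formula m k
  _⇒′_  : Formula m k → Formula m k → Formula m k
  all′  : (x : Fin k) → Formula m k → Formula m k
  ex′   : (x : Fin k) → Formula m k → Formula m k

Free : ∀ {m k} → Fin k → Formula m k → Set
Free z (rel R x y) = z ≡ x ⊎ z ≡ y
Free z (x ≐′ y)    = z ≡ x ⊎ z ≡ y
Free z (¬′ φ)      = Free z φ
Free z (φ ∧′ ψ)    = Free z φ ⊎ Free z ψ
Free z (φ ∨′ ψ)    = Free z φ ⊎ Free z ψ
Free z (φ ⇒′ ψ)    = Free z φ ⊎ Free z ψ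
Free z (all′ x φ)  = z ≢ x × Free z φ
Free z (ex′ x φ)   = z ≢ x × Free z φ

record Sentence (m k : ℕ) : Set where
  constructor sentence
  field
    formula : Formula m k
    closed  : ∀ x → ¬ Free x formula

-- Relations are Bool-valued: this is the classical notion of a relation on a
-- finite set, and it makes satisfaction below decidable, so that the
-- type-theoretic reading of the connectives agrees with the classical one.
record FiniteStructure (m : ℕ) : Set₁ where
  field
    Carrier     : Set
    cardinality : ℕ
    enumeration : Carrier ↔ Fin cardinality
    nonempty    : 0 < cardinality
    interp      : Fin m → Carrier → Carrier → Bool

open FiniteStructure public

infix 3 _,_⊩_ _⊨_

_,_⊩_ : ∀ {m k} (M : FiniteStructure m) → Vector (Carrier M) k → Formula m k → Set
M , v ⊩ rel R x y = T (interp M R (v x) (v y))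
M , v ⊩ x ≐′ y    = v x ≡ v y
M , v ⊩ ¬′ φ      = ¬ (M , v ⊩ φ)
M , v ⊩ φ ∧′ ψ    = (M , v ⊩ φ) × (M , v ⊩ ψ)
M , v ⊩ φ ∨′ ψ    = (M , v ⊩ φ) ⊎ (M , v ⊩ ψ)
M , v ⊩ φ ⇒′ ψ    = (M , v ⊩ φ) → (M , v ⊩ ψ)
M , v ⊩ all′ x φ  = ∀ (a : Carrier M) → M , updateAt v x (const a) ⊩ φ
M , v ⊩ ex′ x φ   = ∃[ a ] (M , updateAt v x (const a) ⊩ φ)

-- A sentence has no free variables and domains are nonempty, so quantifying
-- over all assignments is the same as picking any one of them.
_⊨_ : ∀ {m k} → FiniteStructure m → Sentence m k → Set
M ⊨ Φ = ∀ v → M , v ⊩ Sentence.formula Φ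

Spec : ∀ {m k} → Sentence m k → Pred ℕ (lsuc 0ℓ)
Spec {m} Φ n = ∃[ M ] (cardinality {m} M ≡ n × M ⊨ Φ)

Image : ∀ {a b ℓ : Level} {A : Set a} {B : Set b} →
        (A → B) → Pred A ℓ → Pred B (a ⊔ b ⊔ ℓ)
Image f P y = ∃[ x ] (x ∈ P × y ≡ f x)

-- The two parts are the fibres of side.
IsUndirectedBipartite : FiniteStructure 1 → Set
IsUndirectedBipartite M =
  (∀ a b → T (E a b) → T (E b a)) ×
  ∃ λ (side : Carrier M → Bool) → (∀ a b → T (E a b) → side a ≢ side b)
  where
  E : Carrier M → Carrier M → Bool
  E = interp M zero

-- A structure A is coded by a graph with three kinds of copies of each element:
-- R₀ a, R₁ a and, for every symbol R (equality included), L R a.  The edges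
-- L R a – R₀ b say a = b and the edges L R a – R₁ b say R a b, so R x y becomes a
-- path R₀ x – L R x – R₁ y – L (=) y – R₀ y whose vertices have prescribed kinds.
-- The kinds are recognised by their adjacency to a fixed half graph d i – c j
-- (j ≤ i), whose vertices are definable one after the other.  Everything is a
-- relation-algebraic expression, and composition of relations takes only three
-- variables.  The new sentence says that the kinds partition the graph and that
-- the copies of each kind correspond bijectively to the vertices of kind R₀;
-- hence a model with n vertices of kind R₀ has exactly pn + q vertices.
module Submission where

open import Data.Bool using (Bool; true; false; T; not; if_then_else_)
open import Data.Bool.Properties using (T?; T-irrelevant)
open import Data.Empty using (⊥; ⊥-elim)
open import Data.Fin using (Fin; zero; suc; toℕ; fromℕ; fromℕ<; inject₁)
open import Data.Fin.Permutation using (↔⇒≡)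
import Data.Fin as Fin
import Data.Fin.Properties as Fin
open import Data.Integer using (ℤ; +_; 1ℤ; _+_; _*_; _≥_)
import Data.Integer as ℤ
import Data.Integer.Properties as ℤ
open import Data.List using (List; []; _∷_; foldr; allFin)
open import Data.List.Membership.Propositional using () renaming (_∈_ to _∈ₗ_)
open import Data.List.Membership.Propositional.Properties using (∈-allFin)
open import Data.List.Relation.Unary.Any using (here; there)
open import Data.Nat as ℕ using (ℕ; zero; suc; s≤s; z≤n)
import Data.Nat.Properties as ℕ
open import Data.Product using (_×_; _,_; ∃; ∃-syntax; Σ-syntax; proj₁; proj₂)
open import Data.Product.Function.NonDependent.Propositional using (_×-⇔_; _×-↔_)
open import Data.Sum using (_⊎_; inj₁; inj₂)
open import Data.Sum.Function.Propositional using (_⊎-⇔_; _⊎-↔_)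
open import Data.Unit using (⊤; tt)
open import Data.Vec.Functional using (Vector; updateAt)
open import Data.Vec.Functional.Properties using (updateAt-updates; updateAt-minimal; updateAt-id-local)
open import Function using (_∘_; const; _↔_; _⇔_; mk⇔; mk⤖; mk↔ₛ′; Equivalence; Inverse; Injective)
open import Function.Consequences.Propositional using (strictlySurjective⇒surjective)
open import Function.Construct.Identity using (↔-id; ⇔-id)
open import Function.Properties.Bijection using (⤖⇒↔)
open import Function.Properties.Equivalence using () renaming (trans to ⇔-trans)
open import Function.Properties.Inverse using (↔-sym; ↔-trans; ↔⇒↣)
open import Function.Related.TypeIsomorphisms using (→-cong-⇔; ¬-cong-⇔)
open import Relation.Binary.Definitions using (DecidableEquality)
open import Relation.Binary.PropositionalEquality
open import Relation.Nullary using (¬_; Dec; yes; no; ¬?; _×-dec_; _⊎-dec_; _→-dec_)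
open import Relation.Nullary.Decidable using (map′; ⌊_⌋; toWitness; fromWitness)
open import Relation.Unary using (_≐_)
open import Defs

open Equivalence using (to; from)

-- Equivalences under quantifiers, and counting decidable subsets of finite sets.

∃-cong-⇔ : {A : Set} {B C : A → Set} → (∀ a → B a ⇔ C a) → ∃ B ⇔ ∃ C
∃-cong-⇔ B⇔C = mk⇔ (λ (a , b) → a , to (B⇔C a) b) (λ (a , c) → a , from (B⇔C a) c)

∀-cong-⇔ : {A : Set} {B C : A → Set} → (∀ a → B a ⇔ C a) → (∀ a → B a) ⇔ (∀ a → C a)
∀-cong-⇔ B⇔C = mk⇔ (λ b a → to (B⇔C a) (b a)) (λ c a → from (B⇔C a) (c a))

↔⇒≟ : ∀ {n} {A : Set} → A ↔ Fin n → DecidableEquality A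
↔⇒≟ A↔n = Fin.inj⇒≟ (↔⇒↣ A↔n)

-- Supplies the cardinality of the structure read off from a graph model. Membership is given by `T`
-- of a Boolean, so every index in the subset is counted once.
subset-finite : ∀ {n} (b : Fin n → Bool) → ∃[ c ] ((∃[ i ] T (b i)) ↔ Fin c)
subset-finite {zero}  b = 0 , mk↔ₛ′ (λ ()) (λ ()) (λ ()) (λ ())
subset-finite {suc n} b with subset-finite (b ∘ suc)
... | c , tail↔c = head (b zero) refl
  where
  Head : Bool → Set
  Head h = T h ⊎ (∃[ i ] T (b (suc i)))

  split : (∃[ i ] T (b i)) ↔ Head (b zero)
  split = mk↔ₛ′
    (λ { (zero , t) → inj₁ t ; (suc i , t) → inj₂ (i , t) })
    (λ { (inj₁ t) → zero , t ; (inj₂ (i , t)) → suc i , t })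
    (λ { (inj₁ t) → refl ; (inj₂ (i , t)) → refl })
    (λ { (zero , t) → refl ; (suc i , t) → refl })

  head : ∀ h → b zero ≡ h → ∃[ c ] ((∃[ i ] T (b i)) ↔ Fin c)
  head true  eq = suc c , ↔-trans split (subst (λ h → Head h ↔ Fin (suc c)) (sym eq)
    (↔-trans (↔-sym Fin.1↔⊤ ⊎-↔ tail↔c) (↔-sym Fin.+↔⊎)))
  head false eq = c , ↔-trans split (subst (λ h → Head h ↔ Fin c) (sym eq)
    (↔-trans (↔-sym Fin.0↔⊥ ⊎-↔ tail↔c) (↔-sym (Fin.+↔⊎ {0}))))

-- Decidability of satisfaction in finite structures.

module _ {m : ℕ} (M : FiniteStructure m) where

  private
    module En = Inverse (enumeration M)

  _≟ᶜ_ : DecidableEquality (Carrier M)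
  _≟ᶜ_ = ↔⇒≟ (enumeration M)

  all-dec : {P : Carrier M → Set} → (∀ a → Dec (P a)) → Dec (∀ a → P a)
  all-dec {P} P? = map′ (λ h a → subst P (En.strictlyInverseʳ a) (h (En.to a)))
                        (λ h i → h (En.from i)) (Fin.all? (P? ∘ En.from))

  any-dec : {P : Carrier M → Set} → (∀ a → Dec (P a)) → Dec (∃ P)
  any-dec {P} P? = map′ (λ (i , p) → En.from i , p)
                        (λ (a , p) → En.to a , subst P (sym (En.strictlyInverseʳ a)) p)
                        (Fin.any? (P? ∘ En.from))

  -- Quantifiers range over an enumerated carrier. Decidability later turns definable relations of a
  -- graph into Boolean ones.
  satisfies? : ∀ {k} (φ : Formula m k) v → Dec (M , v ⊩ φ)
  satisfies? (rel R x y) v = T? _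
  satisfies? (x ≐′ y)    v = v x ≟ᶜ v y
  satisfies? (¬′ φ)      v = ¬? (satisfies? φ v)
  satisfies? (φ ∧′ ψ)    v = satisfies? φ v ×-dec satisfies? ψ v
  satisfies? (φ ∨′ ψ)    v = satisfies? φ v ⊎-dec satisfies? ψ v
  satisfies? (φ ⇒′ ψ)    v = satisfies? φ v →-dec satisfies? ψ v
  satisfies? (all′ x φ)  v = all-dec λ a → satisfies? φ (updateAt v x (const a))
  satisfies? (ex′ x φ)   v = any-dec λ a → satisfies? φ (updateAt v x (const a))

-- Universal closure

module _ {m k : ℕ} where

  all* : List (Fin k) → Formula m k → Formula m k
  all* xs φ = foldr all′ φ xs

  all*-binds : ∀ {z} xs φ → z ∈ₗ xs → ¬ Free z (all* xs φ)
  all*-binds (x ∷ xs) φ (here z≡x)   (z≢x , _)  = z≢x z≡x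
  all*-binds (x ∷ xs) φ (there z∈xs) (_ , free) = all*-binds xs φ z∈xs free

  close : Formula m k → Sentence m k
  close φ = sentence (all* (allFin k) φ) λ z → all*-binds (allFin k) φ (∈-allFin z)

  all*-intro : ∀ (M : FiniteStructure m) xs {φ} →
               (∀ v → M , v ⊩ φ) → ∀ v → M , v ⊩ all* xs φ
  all*-intro M []       h v = h v
  all*-intro M (x ∷ xs) h v = λ a → all*-intro M xs h (updateAt v x (const a))

  -- Without function extensionality, instantiating the quantifiers by v only
  -- returns an assignment that agrees with v pointwise.
  all*-elim : ∀ (M : FiniteStructure m) xs {φ} v →
              M , v ⊩ all* xs φ → ∃[ w ] ((∀ i → w i ≡ v i) × M , w ⊩ φ)
  all*-elim M []       v h = v , (λ _ → refl) , h
  all*-elim M (x ∷ xs) v h with all*-elim M xs _ (h (v x))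
  ... | w , w≗ , hw = w , (λ i → trans (w≗ i) (updateAt-id-local x v refl i)) , hw

-- Definable properties and relations of graphs

module Definability (k₀ : ℕ) where

  k : ℕ
  k = 3 ℕ.+ k₀

  Var : Set
  Var = Fin k

  Graph : Set₁
  Graph = FiniteStructure 1

  -- Two symbols cannot exhaust the first three; here `k` being at least 3 enters.
  fresh : (x y : Var) → ∃[ z ] (x ≢ z × y ≢ z)
  fresh zero          zero          = suc zero , (λ ()) , λ ()
  fresh zero          (suc zero)    = suc (suc zero) , (λ ()) , λ ()
  fresh zero          (suc (suc _)) = suc zero , (λ ()) , λ ()
  fresh (suc zero)    zero          = suc (suc zero) , (λ ()) , λ ()
  fresh (suc (suc _)) zero          = suc zero , (λ ()) , λ ()
  fresh (suc _)       (suc _)       = zero , (λ ()) , λ ()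

  -- The formula is a function of the variable symbol, so applying it to another symbol needs no
  -- substitution. `correct` covers every graph, since the formulas are read both in coded graphs
  -- and in arbitrary models.
  record Unary : Set₁ where
    field
      formula : Var → Formula 1 k
      Holds   : (M : Graph) → Carrier M → Set
      correct : ∀ M v {x a} → v x ≡ a → (M , v ⊩ formula x) ⇔ Holds M a

  record Binary : Set₁ where
    field
      formula : Var → Var → Formula 1 k
      Holds   : (M : Graph) → Carrier M → Carrier M → Set
      correct : ∀ M v {x y a b} → v x ≡ a → v y ≡ b → (M , v ⊩ formula x y) ⇔ Holds M a b

  module U = Unary
  module B = Binary

  assign : {A : Set} → A → A → Vector A k
  assign a b zero    = a
  assign a b (suc _) = b

  holds? : ∀ P M a → Dec (U.Holds P M a)
  holds? P M a = map′ (to ok) (from ok) (satisfies? M (U.formula P zero) (const a))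
    where ok = U.correct P M (const a) refl

  update-new : ∀ {A : Set} {a : A} (v : Vector A k) z → updateAt v z (const a) z ≡ a
  update-new v z = updateAt-updates z v

  update-old : ∀ {A : Set} {a b : A} {v : Vector A k} {x z} →
               x ≢ z → v x ≡ b → updateAt v z (const a) x ≡ b
  update-old {v = v} {x} {z} x≢z eq = trans (updateAt-minimal x z v x≢z) eq

  ⋀ᶠ : ∀ {n} → (Fin n → Formula 1 k) → Formula 1 k
  ⋀ᶠ {zero}  φ = zero ≐′ zero
  ⋀ᶠ {suc n} φ = φ zero ∧′ ⋀ᶠ (φ ∘ suc)

  ⋀ᶠ-correct : ∀ (M : Graph) v {n} (φ : Fin n → Formula 1 k) →
               (M , v ⊩ ⋀ᶠ φ) ⇔ (∀ i → M , v ⊩ φ i)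
  ⋀ᶠ-correct M v {zero}  φ = mk⇔ (λ _ ()) (λ _ → refl)
  ⋀ᶠ-correct M v {suc n} φ = mk⇔
    (λ { (h , hs) zero → h ; (h , hs) (suc i) → to (⋀ᶠ-correct M v (φ ∘ suc)) hs i })
    (λ h → h zero , from (⋀ᶠ-correct M v (φ ∘ suc)) (h ∘ suc))

  ⋁ᶠ : ∀ {n} → (Fin n → Formula 1 k) → Formula 1 k
  ⋁ᶠ {zero}  φ = ¬′ (zero ≐′ zero)
  ⋁ᶠ {suc n} φ = φ zero ∨′ ⋁ᶠ (φ ∘ suc)

  ⋁ᶠ-correct : ∀ (M : Graph) v {n} (φ : Fin n → Formula 1 k) →
               (M , v ⊩ ⋁ᶠ φ) ⇔ (∃[ i ] M , v ⊩ φ i)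
  ⋁ᶠ-correct M v {zero}  φ = mk⇔ (λ h → ⊥-elim (h refl)) (λ ())
  ⋁ᶠ-correct M v {suc n} φ = mk⇔
    (λ { (inj₁ h) → zero , h
       ; (inj₂ hs) → let i , h = to (⋁ᶠ-correct M v (φ ∘ suc)) hs in suc i , h })
    (λ { (zero , h) → inj₁ h ; (suc i , h) → inj₂ (from (⋁ᶠ-correct M v (φ ∘ suc)) (i , h)) })

  module _ {I : Set} {n : ℕ} (I↔n : I ↔ Fin n) where

    private
      module En = Inverse I↔n

    ∀-enum-⇔ : ∀ {P : I → Set} → (∀ i → P (En.from i)) ⇔ (∀ i → P i)
    ∀-enum-⇔ {P} = mk⇔ (λ h i → subst P (En.strictlyInverseʳ i) (h (En.to i))) (λ h i → h (En.from i))

    ∃-enum-⇔ : ∀ {P : I → Set} → (∃[ i ] P (En.from i)) ⇔ ∃ P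
    ∃-enum-⇔ {P} = mk⇔ (λ (i , p) → En.from i , p)
                       (λ (i , p) → En.to i , subst P (sym (En.strictlyInverseʳ i)) p)

    ⋀₁ : (I → Unary) → Unary
    ⋀₁ P = record
      { formula = λ x → ⋀ᶠ λ i → U.formula (P (En.from i)) x
      ; Holds   = λ M a → ∀ i → U.Holds (P i) M a
      ; correct = λ M v eq → ⇔-trans (⋀ᶠ-correct M v _)
          (⇔-trans (∀-cong-⇔ λ i → U.correct (P (En.from i)) M v eq) ∀-enum-⇔)
      }

    ⋁₁ : (I → Unary) → Unary
    ⋁₁ P = record
      { formula = λ x → ⋁ᶠ λ i → U.formula (P (En.from i)) x
      ; Holds   = λ M a → ∃[ i ] U.Holds (P i) M a
      ; correct = λ M v eq → ⇔-trans (⋁ᶠ-correct M v _)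
          (⇔-trans (∃-cong-⇔ λ i → U.correct (P (En.from i)) M v eq) ∃-enum-⇔)
      }

    ⋀₂ : (I → Binary) → Binary
    ⋀₂ P = record
      { formula = λ x y → ⋀ᶠ λ i → B.formula (P (En.from i)) x y
      ; Holds   = λ M a b → ∀ i → B.Holds (P i) M a b
      ; correct = λ M v eq eq′ → ⇔-trans (⋀ᶠ-correct M v _)
          (⇔-trans (∀-cong-⇔ λ i → B.correct (P (En.from i)) M v eq eq′) ∀-enum-⇔)
      }

  infix  9 ¬₁_ ¬₂_
  infixr 8 _⨾_
  infixr 7 _∧₁_ _∧₂_
  infixr 6 _∨₂_
  infixr 5 _⇒₁_ _⇒₂_

  ¬₁_ : Unary → Unary
  ¬₁ P = record
    { formula = λ x → ¬′ U.formula P x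
    ; Holds   = λ M a → ¬ U.Holds P M a
    ; correct = λ M v eq → ¬-cong-⇔ (U.correct P M v eq)
    }

  _∧₁_ : Unary → Unary → Unary
  P ∧₁ Q = record
    { formula = λ x → U.formula P x ∧′ U.formula Q x
    ; Holds   = λ M a → U.Holds P M a × U.Holds Q M a
    ; correct = λ M v eq → U.correct P M v eq ×-⇔ U.correct Q M v eq
    }

  _⇒₁_ : Unary → Unary → Unary
  P ⇒₁ Q = record
    { formula = λ x → U.formula P x ⇒′ U.formula Q x
    ; Holds   = λ M a → U.Holds P M a → U.Holds Q M a
    ; correct = λ M v eq → →-cong-⇔ (U.correct P M v eq) (U.correct Q M v eq)
    }

  ⊥₁ : Unary
  ⊥₁ = record
    { formula = λ x → ¬′ (x ≐′ x)
    ; Holds   = λ M a → ⊥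
    ; correct = λ M v eq → mk⇔ (λ h → h refl) ⊥-elim
    }

  adjacent : Binary
  adjacent = record
    { formula = rel zero
    ; Holds   = λ M a b → T (interp M zero a b)
    ; correct = λ { M v refl refl → ⇔-id _ }
    }

  equal : Binary
  equal = record
    { formula = _≐′_
    ; Holds   = λ M a b → a ≡ b
    ; correct = λ { M v refl refl → ⇔-id _ }
    }

  on-first : Unary → Binary
  on-first P = record
    { formula = λ x y → U.formula P x
    ; Holds   = λ M a b → U.Holds P M a
    ; correct = λ M v eq _ → U.correct P M v eq
    }

  flip₂ : Binary → Binary
  flip₂ P = record
    { formula = λ x y → B.formula P y x
    ; Holds   = λ M a b → B.Holds P M b a
    ; correct = λ M v eq eq′ → B.correct P M v eq′ eq
    }

  on-second : Unary → Binary
  on-second P = flip₂ (on-first P)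

  ¬₂_ : Binary → Binary
  ¬₂ P = record
    { formula = λ x y → ¬′ B.formula P x y
    ; Holds   = λ M a b → ¬ B.Holds P M a b
    ; correct = λ M v eq eq′ → ¬-cong-⇔ (B.correct P M v eq eq′)
    }

  _∧₂_ : Binary → Binary → Binary
  P ∧₂ Q = record
    { formula = λ x y → B.formula P x y ∧′ B.formula Q x y
    ; Holds   = λ M a b → B.Holds P M a b × B.Holds Q M a b
    ; correct = λ M v eq eq′ → B.correct P M v eq eq′ ×-⇔ B.correct Q M v eq eq′
    }

  _∨₂_ : Binary → Binary → Binary
  P ∨₂ Q = record
    { formula = λ x y → B.formula P x y ∨′ B.formula Q x y
    ; Holds   = λ M a b → B.Holds P M a b ⊎ B.Holds Q M a b
    ; correct = λ M v eq eq′ → B.correct P M v eq eq′ ⊎-⇔ B.correct Q M v eq eq′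
    }

  _⇒₂_ : Binary → Binary → Binary
  P ⇒₂ Q = record
    { formula = λ x y → B.formula P x y ⇒′ B.formula Q x y
    ; Holds   = λ M a b → B.Holds P M a b → B.Holds Q M a b
    ; correct = λ M v eq eq′ → →-cong-⇔ (B.correct P M v eq eq′) (B.correct Q M v eq eq′)
    }

  some : Binary → Unary
  some P = record
    { formula = λ x → let z , _ = fresh x x in ex′ z (B.formula P x z)
    ; Holds   = λ M a → ∃[ c ] B.Holds P M a c
    ; correct = λ M v {x} eq → let z , x≢z , _ = fresh x x in
        ∃-cong-⇔ λ c → B.correct P M _ (update-old x≢z eq) (update-new v z)
    }

  every : Binary → Unary
  every P = record
    { formula = λ x → let z , _ = fresh x x in all′ z (B.formula P x z)
    ; Holds   = λ M a → ∀ c → B.Holds P M a c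
    ; correct = λ M v {x} eq → let z , x≢z , _ = fresh x x in
        ∀-cong-⇔ λ c → B.correct P M _ (update-old x≢z eq) (update-new v z)
    }

  -- Composition is the only place where a third variable symbol is needed.
  _⨾_ : Binary → Binary → Binary
  P ⨾ Q = record
    { formula = λ x y → let z , _ = fresh x y in ex′ z (B.formula P x z ∧′ B.formula Q z y)
    ; Holds   = λ M a b → ∃[ c ] (B.Holds P M a c × B.Holds Q M c b)
    ; correct = λ M v {x} {y} eq eq′ → let z , x≢z , y≢z = fresh x y in
        ∃-cong-⇔ λ c → B.correct P M _ (update-old x≢z eq) (update-new v z)
                   ×-⇔ B.correct Q M _ (update-new v z) (update-old y≢z eq′)
    }

-- Interpretations of structures in graphs

-- Each element a contributes one vertex (a , t) for every place t; on top of
-- these come the extra vertices, which do not depend on the structure.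
record Layout (m : ℕ) : Set₁ where
  field
    Place Extra : Set
    p q         : ℕ
    places      : Place ↔ Fin (suc p)
    extras      : Extra ↔ Fin q

  Vertex : FiniteStructure m → Set
  Vertex A = (Carrier A × Place) ⊎ Extra

  field
    edge : ∀ A → Vertex A → Vertex A → Bool

  vertices : ∀ A → Vertex A ↔ Fin (cardinality A ℕ.* suc p ℕ.+ q)
  vertices A = ↔-trans (↔-trans (enumeration A ×-↔ places) (↔-sym Fin.*↔×) ⊎-↔ extras) (↔-sym Fin.+↔⊎)

  graph : FiniteStructure m → FiniteStructure 1
  graph A = record
    { Carrier     = Vertex A
    ; cardinality = cardinality A ℕ.* suc p ℕ.+ q
    ; enumeration = vertices A
    ; nonempty    = ℕ.<-≤-trans (ℕ.<-≤-trans (nonempty A) (ℕ.m≤m*n (cardinality A) (suc p)))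
                                (ℕ.m≤m+n _ q)
    ; interp      = λ _ → edge A
    }

module _ (k₀ m : ℕ) where

  open Definability k₀

  record Interpretation : Set₁ where
    field
      layout      : Layout m

    open Layout layout public

    field
      base        : Place
      domain side : Unary
      copy        : Place → Binary
      point       : Extra → Unary
      atom        : Fin m → Binary
      domain-correct : ∀ A v → U.Holds domain (graph A) v ⇔ (∃[ a ] v ≡ inj₁ (a , base))
      copy-correct   : ∀ A t v a → B.Holds (copy t) (graph A) v (inj₁ (a , base)) ⇔ v ≡ inj₁ (a , t)
      point-correct  : ∀ A j v → U.Holds (point j) (graph A) v ⇔ v ≡ inj₂ j
      atom-correct   : ∀ A R a b → B.Holds (atom R) (graph A) (inj₁ (a , base)) (inj₁ (b , base)) ⇔ T (interp A R a b)
      edge-symmetric : ∀ A u v → T (edge A u v) → T (edge A v u)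
      edge-crosses   : ∀ A u v → T (edge A u v) →
                       (U.Holds side (graph A) u × ¬ U.Holds side (graph A) v) ⊎
                       (¬ U.Holds side (graph A) u × U.Holds side (graph A) v)

  module _ (I : Interpretation) where

    open Interpretation I

    -- Axioms on roles and the relativised translation.

    Role : Set
    Role = Place ⊎ Extra

    roles : Role ↔ Fin (suc p ℕ.+ q)
    roles = ↔-trans (places ⊎-↔ extras) (↔-sym Fin.+↔⊎)

    -- An extra vertex counts as a common copy of all elements, which makes the axioms uniform in
    -- the role.
    role : Role → Binary
    role (inj₁ t) = copy t
    role (inj₂ j) = on-first (point j)

    -- What a coincidence of role `τ` of one element with role `τ′` of another forces: a
    -- contradiction for distinct roles, equality of the elements for one place, nothing for one
    -- extra vertex.
    collision : Role → Role → Binary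
    collision τ τ′ with ↔⇒≟ roles τ τ′
    ... | no  _ = on-first ⊥₁
    collision (inj₁ t) τ′ | yes _ = equal
    collision (inj₂ j) τ′ | yes _ = on-first (¬₁ ⊥₁)

    -- The first two make the assignment of vertices to roles of elements surjective and total.
    covered realised inhabited : Unary
    covered   = ⋁₁ roles λ τ → some (role τ ∧₂ on-second domain)
    realised  = ⋀₁ roles λ τ → domain ⇒₁ some (flip₂ (role τ))
    inhabited = some (on-second domain)

    -- The first two make the same assignment single-valued and injective.
    unique disjoint symmetric bipartite : Binary
    unique    = ⋀₂ roles λ τ → ((role τ ∧₂ on-second domain) ⨾ flip₂ (role τ)) ⇒₂ equal
    disjoint  = ⋀₂ roles λ τ → ⋀₂ roles λ τ′ →
      (on-first domain ∧₂ on-second domain) ∧₂ (flip₂ (role τ) ⨾ role τ′) ⇒₂ collision τ τ′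
    symmetric = adjacent ⇒₂ flip₂ adjacent
    bipartite = adjacent ⇒₂
      (on-first side ∧₂ on-second (¬₁ side)) ∨₂ (on-first (¬₁ side) ∧₂ on-second side)

    axiom₁ : Unary
    axiom₁ = covered ∧₁ realised ∧₁ inhabited

    axiom₂ : Binary
    axiom₂ = unique ∧₂ disjoint ∧₂ symmetric ∧₂ bipartite

    translate : Formula m k → Formula 1 k
    translate (rel R x y) = B.formula (atom R) x y
    translate (x ≐′ y)    = x ≐′ y
    translate (¬′ φ)      = ¬′ translate φ
    translate (φ ∧′ ψ)    = translate φ ∧′ translate ψ
    translate (φ ∨′ ψ)    = translate φ ∨′ translate ψ
    translate (φ ⇒′ ψ)    = translate φ ⇒′ translate ψ
    translate (all′ x φ)  = all′ x (U.formula domain x ⇒′ translate φ)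
    translate (ex′ x φ)   = ex′ x (U.formula domain x ∧′ translate φ)

    module Transfer
      (A : FiniteStructure m) (M : Graph) (ι : Carrier A → Carrier M)
      (ι-injective : ∀ {a b} → ι a ≡ ι b → a ≡ b)
      (ι-domain : ∀ x → U.Holds domain M x ⇔ (∃[ a ] x ≡ ι a))
      (ι-atom : ∀ R a b → B.Holds (atom R) M (ι a) (ι b) ⇔ T (interp A R a b))
      where

      update-≗ : ∀ {v : Vector (Carrier M) k} {w : Vector (Carrier A) k} x {a} → (∀ i → v i ≡ ι (w i)) →
                 ∀ i → updateAt v x (const (ι a)) i ≡ ι (updateAt w x (const a) i)
      update-≗ {v} {w} x eq i with i Fin.≟ x
      ... | yes refl = trans (updateAt-updates x v) (cong ι (sym (updateAt-updates x w)))
      ... | no  i≢x  = trans (updateAt-minimal i x v i≢x)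
                             (trans (eq i) (cong ι (sym (updateAt-minimal i x w i≢x))))

      -- Relativised quantifiers range exactly over the image of `ι`. As `ι` is abstract, this
      -- serves both the graph built from a structure and the structure extracted from a model.
      translate-correct : ∀ φ {v w} → (∀ i → v i ≡ ι (w i)) → (M , v ⊩ translate φ) ⇔ (A , w ⊩ φ)
      translate-correct (rel R x y) {v} eq = ⇔-trans (B.correct (atom R) M v (eq x) (eq y)) (ι-atom R _ _)
      translate-correct (x ≐′ y) eq = mk⇔
        (λ h → ι-injective (trans (sym (eq x)) (trans h (eq y))))
        (λ h → trans (eq x) (trans (cong ι h) (sym (eq y))))
      translate-correct (¬′ φ)   eq = ¬-cong-⇔ (translate-correct φ eq)
      translate-correct (φ ∧′ ψ) eq = translate-correct φ eq ×-⇔ translate-correct ψ eq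
      translate-correct (φ ∨′ ψ) eq = translate-correct φ eq ⊎-⇔ translate-correct ψ eq
      translate-correct (φ ⇒′ ψ) eq = →-cong-⇔ (translate-correct φ eq) (translate-correct ψ eq)
      translate-correct (all′ x φ) {v} eq = mk⇔
        (λ h a → to (translate-correct φ (update-≗ x eq))
          (h (ι a) (from (U.correct domain M _ (update-new v x)) (from (ι-domain _) (a , refl)))))
        (λ h b d → relative h b (to (ι-domain b) (to (U.correct domain M _ (update-new v x)) d)))
        where
        relative : (∀ a → _) → ∀ b → (∃[ a ] b ≡ ι a) → M , updateAt v x (const b) ⊩ translate φ
        relative h b (a , refl) = from (translate-correct φ (update-≗ x eq)) (h a)
      translate-correct (ex′ x φ) {v} {w} eq = mk⇔
        (λ (b , d , h) → relative b (to (ι-domain b) (to (U.correct domain M _ (update-new v x)) d)) h)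
        (λ (a , h) → ι a , from (U.correct domain M _ (update-new v x)) (from (ι-domain _) (a , refl))
                         , from (translate-correct φ (update-≗ x eq)) h)
        where
        relative : ∀ b → (∃[ a ] b ≡ ι a) → M , updateAt v x (const b) ⊩ translate φ → A , w ⊩ ex′ x φ
        relative b (a , refl) h = a , to (translate-correct φ (update-≗ x eq)) h

    -- The closure will quantify over assignments to all vertices, whereas `translate` is meaningful
    -- only for assignments into the domain; hence the guard on every variable.
    interpreted : Formula m k → Formula 1 k
    interpreted φ = U.formula axiom₁ zero ∧′ B.formula axiom₂ zero (suc zero)
                  ∧′ (⋀ᶠ (U.formula domain) ⇒′ translate φ)

    -- From a structure to its graph.

    module Encode (A : FiniteStructure m) where

      G : Graph
      G = graph A

      at : Role → Carrier A → Vertex A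
      at (inj₁ t) a = inj₁ (a , t)
      at (inj₂ j) a = inj₂ j

      ι : Carrier A → Vertex A
      ι a = inj₁ (a , base)

      a₀ : Carrier A
      a₀ = Inverse.from (enumeration A) (fromℕ< (nonempty A))

      role-correct : ∀ τ v a → B.Holds (role τ) G v (ι a) ⇔ v ≡ at τ a
      role-correct (inj₁ t) v a = copy-correct A t v a
      role-correct (inj₂ j) v a = point-correct A j v

      covered-holds : ∀ v → U.Holds covered G v
      covered-holds (inj₁ (a , t)) = inj₁ t , ι a , from (role-correct (inj₁ t) _ a) refl , from (domain-correct A _) (a , refl)
      -- An extra vertex has its role relative to any element, so `a₀` will do.
      covered-holds (inj₂ j) = inj₂ j , ι a₀ , from (role-correct (inj₂ j) _ a₀) refl , from (domain-correct A _) (a₀ , refl)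

      realised-holds : ∀ v → U.Holds realised G v
      realised-holds v τ d with to (domain-correct A v) d
      ... | a , refl = at τ a , from (role-correct τ _ a) refl

      unique-holds : ∀ u v → B.Holds unique G u v
      unique-holds u v τ (w , (ru , d) , rv) with to (domain-correct A w) d
      ... | a , refl = trans (to (role-correct τ u a) ru) (sym (to (role-correct τ v a) rv))

      collision-holds : ∀ τ τ′ a a′ → at τ a ≡ at τ′ a′ → B.Holds (collision τ τ′) G (ι a) (ι a′)
      collision-holds τ τ′ a a′ eq with ↔⇒≟ roles τ τ′
      collision-holds (inj₁ t) (inj₁ .t) a .a refl | yes _ = refl
      collision-holds (inj₂ j) τ′ a a′ eq | yes _ = λ ()
      collision-holds (inj₁ t) (inj₁ .t) a .a refl | no τ≢τ′ = τ≢τ′ refl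
      collision-holds (inj₂ j) (inj₂ .j) a a′ refl | no τ≢τ′ = τ≢τ′ refl

      disjoint-holds : ∀ u v → B.Holds disjoint G u v
      disjoint-holds u v τ τ′ ((du , dv) , w , rw , rw′)
        with to (domain-correct A u) du | to (domain-correct A v) dv
      ... | a , refl | a′ , refl = collision-holds τ τ′ a a′
        (trans (sym (to (role-correct τ w a) rw)) (to (role-correct τ′ w a′) rw′))

      ι-injective : ∀ {a b} → ι a ≡ ι b → a ≡ b
      ι-injective refl = refl

      open Transfer A G ι ι-injective (domain-correct A) (atom-correct A)

      encode : ∀ φ → (∀ w → A , w ⊩ φ) → G ⊨ close (interpreted φ)
      encode φ h = all*-intro G (allFin k) λ v →
          from (U.correct axiom₁ G v refl)
            (covered-holds _ , realised-holds _ , ι a₀ , from (domain-correct A _) (a₀ , refl))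
        , from (B.correct axiom₂ G v refl refl)
            (unique-holds _ _ , disjoint-holds _ _ , edge-symmetric A _ _ , edge-crosses A _ _)
        -- The guard gives, for each variable, the element whose base copy it denotes; these
        -- elements form the assignment in `A`.
        , λ d → let w = λ i → to (domain-correct A (v i)) (to (U.correct domain G v refl) (to (⋀ᶠ-correct G v (U.formula domain)) d i))
                in from (translate-correct φ {v} {proj₁ ∘ w} (proj₂ ∘ w)) (h _)

    -- From a graph model back to a structure.

    module Decode (M : Graph) (φ : Formula m k) (M⊨ : M ⊨ close (interpreted φ)) where

      private
        module En = Inverse (enumeration M)

      elim : ∀ v → ∃[ w ] ((∀ i → w i ≡ v i) × M , w ⊩ interpreted φ)
      elim v = all*-elim M (allFin k) v (M⊨ v)

      axiom₁-holds : ∀ a → U.Holds axiom₁ M a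
      axiom₁-holds a with elim (const a)
      ... | w , w≗ , h , _ = to (U.correct axiom₁ M w (w≗ zero)) h

      axiom₂-holds : ∀ a b → B.Holds axiom₂ M a b
      axiom₂-holds a b with elim (assign a b)
      ... | w , w≗ , _ , h , _ = to (B.correct axiom₂ M w (w≗ zero) (w≗ (suc zero))) h

      undirected-bipartite : IsUndirectedBipartite M
      undirected-bipartite = (λ a b → proj₁ (proj₂ (proj₂ (axiom₂-holds a b)))) , (λ a → ⌊ holds? side M a ⌋) , crosses
        where
        crosses : ∀ a b → T (interp M zero a b) → ⌊ holds? side M a ⌋ ≢ ⌊ holds? side M b ⌋
        crosses a b e eq with proj₂ (proj₂ (proj₂ (axiom₂-holds a b))) e
        ... | inj₁ (sa , ¬sb) = ¬sb (toWitness (subst T eq (fromWitness sa)))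
        ... | inj₂ (¬sa , sb) = ¬sa (toWitness (subst T (sym eq) (fromWitness sb)))

      inDomain : Fin (cardinality M) → Bool
      inDomain i = ⌊ holds? domain M (En.from i) ⌋

      finite : ∃[ c ] ((∃[ i ] T (inDomain i)) ↔ Fin c)
      finite = subset-finite inDomain

      -- Indices with a Boolean membership test, rather than vertices with a proof of `domain`: the
      -- test has at most one proof, so `ι` is injective.
      Element : Set
      Element = ∃[ i ] T (inDomain i)

      ι : Element → Carrier M
      ι (i , _) = En.from i

      ι-injective : ∀ {a b} → ι a ≡ ι b → a ≡ b
      ι-injective {i , s} {j , t} eq
        with trans (sym (En.strictlyInverseˡ i)) (trans (cong En.to eq) (En.strictlyInverseˡ j))
      ... | refl = cong (i ,_) (T-irrelevant s t)

      ι-domain : ∀ x → U.Holds domain M x ⇔ (∃[ a ] x ≡ ι a)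
      ι-domain x = mk⇔
        (λ d → (En.to x , fromWitness (subst (U.Holds domain M) (sym (En.strictlyInverseʳ x)) d))
             , sym (En.strictlyInverseʳ x))
        (λ { ((i , t) , refl) → toWitness t })

      ι-in-domain : ∀ a → U.Holds domain M (ι a)
      ι-in-domain a = from (ι-domain _) (a , refl)

      a₀ : Element
      a₀ = let (_ , _ , _ , d) = axiom₁-holds (En.from (fromℕ< (nonempty M))) in proj₁ (to (ι-domain _) d)

      atom? : ∀ R a b → Dec (B.Holds (atom R) M (ι a) (ι b))
      atom? R a b = map′ (to ok) (from ok) (satisfies? M (B.formula (atom R) zero (suc zero)) (assign (ι a) (ι b)))
        where ok = B.correct (atom R) M (assign (ι a) (ι b)) refl refl

      A : FiniteStructure m
      A = record
        { Carrier     = Element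
        ; cardinality = proj₁ finite
        ; enumeration = proj₂ finite
        ; nonempty    = ℕ.≤-trans (s≤s z≤n) (Fin.toℕ<n (Inverse.to (proj₂ finite) a₀))
        ; interp      = λ R a b → ⌊ atom? R a b ⌋
        }

      ι-atom : ∀ R a b → B.Holds (atom R) M (ι a) (ι b) ⇔ T (interp A R a b)
      ι-atom R a b = mk⇔ fromWitness toWitness

      open Transfer A M ι ι-injective ι-domain ι-atom

      satisfied : ∀ w → A , w ⊩ φ
      satisfied w with elim (ι ∘ w)
      ... | v , v≗ , _ , _ , h = to (translate-correct φ v≗)
        (h (from (⋀ᶠ-correct M v (U.formula domain)) λ i → from (U.correct domain M v (v≗ i)) (ι-in-domain (w i))))

      pick : ∀ τ a → ∃[ x ] B.Holds (role τ) M x (ι a)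
      pick τ a = let (_ , r , _) = axiom₁-holds (ι a) in r τ (ι-in-domain a)

      -- The choices made by `pick` are harmless because `unique` determines the vertex.
      vertex : Vertex A → Carrier M
      vertex (inj₁ (a , t)) = proj₁ (pick (inj₁ t) a)
      vertex (inj₂ j)       = proj₁ (pick (inj₂ j) a₀)

      same-role : ∀ τ {x x′} a → B.Holds (role τ) M x (ι a) → B.Holds (role τ) M x′ (ι a) → x ≡ x′
      same-role τ {x} {x′} a r r′ = proj₁ (axiom₂-holds x x′) τ (ι a , (r , ι-in-domain a) , r′)

      separated : ∀ τ τ′ a a′ {x} → B.Holds (role τ) M x (ι a) → B.Holds (role τ′) M x (ι a′) →
                  B.Holds (collision τ τ′) M (ι a) (ι a′)
      separated τ τ′ a a′ {x} r r′ = proj₁ (proj₂ (axiom₂-holds (ι a) (ι a′))) τ τ′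
        ((ι-in-domain a , ι-in-domain a′) , x , r , r′)

      -- A common image is a collision of two roles, and deciding whether the roles agree evaluates
      -- `collision` to the required equality or to falsity.
      vertex-injective : Injective _≡_ _≡_ vertex
      vertex-injective {u} {u′} eq = case-roles u u′ eq
        where
        meet : ∀ τ τ′ a a′ → proj₁ (pick τ a) ≡ proj₁ (pick τ′ a′) → B.Holds (collision τ τ′) M (ι a) (ι a′)
        meet τ τ′ a a′ eq = separated τ τ′ a a′ (proj₂ (pick τ a))
          (subst (λ x → B.Holds (role τ′) M x (ι a′)) (sym eq) (proj₂ (pick τ′ a′)))

        decide-place : ∀ t t′ a a′ → B.Holds (collision (inj₁ t) (inj₁ t′)) M (ι a) (ι a′) →
                       _≡_ {A = Vertex A} (inj₁ (a , t)) (inj₁ (a′ , t′))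
        decide-place t t′ a a′ h with ↔⇒≟ roles (inj₁ t) (inj₁ t′)
        -- For distinct roles `h` would prove falsity, so only this case remains.
        ... | yes refl = cong (λ b → inj₁ (b , t)) (ι-injective h)

        decide-extra : ∀ j j′ a a′ → B.Holds (collision (inj₂ j) (inj₂ j′)) M (ι a) (ι a′) →
                       _≡_ {A = Vertex A} (inj₂ j) (inj₂ j′)
        decide-extra j j′ a a′ h with ↔⇒≟ roles (inj₂ j) (inj₂ j′)
        ... | yes refl = refl

        clash : ∀ t j a a′ → ¬ B.Holds (collision (inj₁ t) (inj₂ j)) M (ι a) (ι a′)
        clash t j a a′ h with ↔⇒≟ roles (inj₁ t) (inj₂ j)
        ... | no _ = h

        case-roles : ∀ u u′ → vertex u ≡ vertex u′ → u ≡ u′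
        case-roles (inj₁ (a , t)) (inj₁ (a′ , t′)) eq = decide-place t t′ a a′ (meet (inj₁ t) (inj₁ t′) a a′ eq)
        case-roles (inj₁ (a , t)) (inj₂ j)         eq = ⊥-elim (clash t j a a₀ (meet (inj₁ t) (inj₂ j) a a₀ eq))
        case-roles (inj₂ j)       (inj₁ (a , t))   eq = ⊥-elim (clash t j a a₀ (meet (inj₁ t) (inj₂ j) a a₀ (sym eq)))
        case-roles (inj₂ j)       (inj₂ j′)        eq = decide-extra j j′ a₀ a₀ (meet (inj₂ j) (inj₂ j′) a₀ a₀ eq)

      vertex-surjective : ∀ x → ∃[ u ] vertex u ≡ x
      vertex-surjective x with proj₁ (axiom₁-holds x)
      ... | τ , y , r , d with to (ι-domain y) d
      vertex-surjective x | inj₁ t , y , r , d | a , refl =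
        inj₁ (a , t) , same-role (inj₁ t) a (proj₂ (pick (inj₁ t) a)) r
      vertex-surjective x | inj₂ j , y , r , d | a , refl =
        -- `r` was obtained at `a`, but the role of an extra vertex ignores its second argument.
        inj₂ j , same-role (inj₂ j) a₀ (proj₂ (pick (inj₂ j) a₀)) r

      -- The axioms do not make `M` isomorphic to `graph A`; the bijection `vertex` alone fixes the
      -- count.
      cardinality-decoded : cardinality M ≡ cardinality A ℕ.* suc p ℕ.+ q
      cardinality-decoded = ↔⇒≡ (↔-trans (↔-sym (enumeration M))
        (↔-trans (↔-sym (⤖⇒↔ (mk⤖ (vertex-injective , strictlySurjective⇒surjective vertex-surjective)))) (vertices A)))

    -- `Decode` gives one inclusion and `Encode` the other; the slope is the number of places and
    -- the offset the number of extra vertices.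
    spectrum-image : (Φ : Sentence m k) →
      Σ[ Φ' ∈ Sentence 1 k ] Σ[ p ∈ ℤ ] Σ[ q ∈ ℤ ]
      ( p ≥ 1ℤ
      × Image +_ (Spec Φ') ≐ Image (λ n → p * + n + q) (Spec Φ)
      × ((M : FiniteStructure 1) → M ⊨ Φ' → IsUndirectedBipartite M) )
    spectrum-image Φ = close (interpreted φ) , + suc p , + q , ℤ.+≤+ (s≤s z≤n)
      , ( (λ { (_ , (M , refl , M⊨) , refl) → let A = Decode.A M φ M⊨ in
               cardinality A , (A , refl , Decode.satisfied M φ M⊨)
             , trans (cong +_ (Decode.cardinality-decoded M φ M⊨)) (affine (cardinality A)) })
        , (λ { (_ , (A , refl , A⊨) , refl) →
               cardinality A ℕ.* suc p ℕ.+ q , (graph A , refl , Encode.encode A φ A⊨)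
             , sym (affine (cardinality A)) }) )
      , λ M M⊨ → Decode.undirected-bipartite M φ M⊨
      where
      φ = Sentence.formula Φ

      affine : ∀ n → + (n ℕ.* suc p ℕ.+ q) ≡ + suc p * + n + + q
      affine n = cong (ℤ._+ + q) (trans (cong +_ (ℕ.*-comm n (suc p))) (ℤ.pos-* (suc p) n))

-- The bipartite graph of a structure

module GraphOf (k₀ m₀ : ℕ) where

  open Definability k₀

  -- Index zero gives a vertex `c zero` seen by all left vertices, the next `suc m` indices are
  -- marks, and the last is never a mark.
  m N : ℕ
  m = suc m₀
  N = 3 ℕ.+ m

  -- The left vertices are e, the d i and the copies L i; the right vertices
  -- are the c i and the copies R₀ and R₁.  The copy R₀ of an element stands
  -- for the element itself.
  data Place : Set where
    R₀ R₁ : Place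
    L     : Fin (suc m) → Place

  data Extra : Set where
    c d : Fin N → Extra
    e   : Extra

  places : Place ↔ Fin (suc (suc (suc m)))
  places = mk↔ₛ′
    (λ { R₀ → zero ; R₁ → suc zero ; (L i) → suc (suc i) })
    (λ { zero → R₀ ; (suc zero) → R₁ ; (suc (suc i)) → L i })
    (λ { zero → refl ; (suc zero) → refl ; (suc (suc i)) → refl })
    (λ { R₀ → refl ; R₁ → refl ; (L i) → refl })

  extras : Extra ↔ Fin (1 ℕ.+ (N ℕ.+ N))
  extras = ↔-trans
    (mk↔ₛ′ (λ { e → inj₁ zero ; (c i) → inj₂ (inj₁ i) ; (d i) → inj₂ (inj₂ i) })
           (λ { (inj₁ zero) → e ; (inj₂ (inj₁ i)) → c i ; (inj₂ (inj₂ i)) → d i })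
           (λ { (inj₁ zero) → refl ; (inj₂ (inj₁ i)) → refl ; (inj₂ (inj₂ i)) → refl })
           (λ { e → refl ; (c i) → refl ; (d i) → refl }))
    (↔-trans (↔-id (Fin 1) ⊎-↔ ↔-sym Fin.+↔⊎) (↔-sym Fin.+↔⊎))

  last : Fin N
  last = fromℕ (suc (suc m))

  -- The copies L i are adjacent to every c j except c (mark i), which tells them apart.
  mark : Fin (suc m) → Fin N
  mark i = suc (inject₁ i)

  mark-injective : ∀ {i j} → mark i ≡ mark j → i ≡ j
  mark-injective eq = Fin.inject₁-injective (Fin.suc-injective eq)

  last≢mark : ∀ i → last ≢ mark i
  last≢mark i eq = Fin.fromℕ≢inject₁ (Fin.suc-injective eq)

  -- Edges of the coded graph.

  module _ (A : FiniteStructure m) where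

    private
      Vertex : Set
      Vertex = (Carrier A × Place) ⊎ Extra

    related : Fin (suc m) → Carrier A → Carrier A → Bool
    related zero    a b = ⌊ _≟ᶜ_ A a b ⌋
    related (suc R) a b = interp A R a b

    left : Vertex → Bool
    left (inj₁ (_ , L _)) = true
    left (inj₂ (d _))     = true
    left (inj₂ e)         = true
    left _                = false

    -- `e` agrees with `d last` on the `c j`, but also sees every `R₁`, which separates `R₁` from
    -- `R₀`.
    half : Vertex → Vertex → Bool
    half (inj₂ (d i))       (inj₂ (c j))     = ⌊ j Fin.≤? i ⌋
    half (inj₂ e)           (inj₂ (c j))     = true
    half (inj₂ e)           (inj₁ (b , R₁))  = true
    half (inj₁ (a , L i))   (inj₂ (c j))     = ⌊ ¬? (j Fin.≟ mark i) ⌋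
    half (inj₁ (a , L i))   (inj₁ (b , R₀))  = ⌊ _≟ᶜ_ A a b ⌋
    half (inj₁ (a , L i))   (inj₁ (b , R₁))  = related i a b
    half _                  _                = false

    -- `half` is consulted only from left to right, so symmetry and bipartiteness hold whatever its
    -- clauses are.
    edge : Vertex → Vertex → Bool
    edge u v = if left u then (if left v then false else half u v)
                         else (if left v then half v u else false)

    edge-symmetric : ∀ u v → T (edge u v) → T (edge v u)
    edge-symmetric u v with left u | left v
    ... | true  | false = λ t → t
    ... | false | true  = λ t → t

    edge-crosses : ∀ u v → T (edge u v) → (T (left u) × ¬ T (left v)) ⊎ (¬ T (left u) × T (left v))
    edge-crosses u v with left u | left v
    ... | true  | false = λ _ → inj₁ (tt , λ ())
    ... | false | true  = λ _ → inj₂ ((λ ()) , tt)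

  layout : Layout m
  layout = record { places = places ; extras = extras ; edge = edge }

  -- Formulas defining the kinds of vertices.

  open Layout layout using (Vertex; graph)

  -- Exactly one neighbour outside `P`: some outside neighbour from which no outside neighbour
  -- differs, written with a composition to stay within three variables.
  pivot : Unary → Unary
  pivot P = some (outside ∧₂ ¬₂ (outside ⨾ ¬₂ equal))
    where outside = adjacent ∧₂ on-second (¬₁ P)

  neighbour : Unary → Unary
  neighbour P = some (adjacent ∧₂ on-second P)

  -- In the graph of a structure, below j defines the c i with i < j, and d j is
  -- the only vertex with exactly one neighbour outside that set.
  below : ℕ → Unary
  below zero    = ⊥₁
  below (suc j) = neighbour (pivot (below j))

  isC isD : Fin N → Unary
  isC j = below (suc (toℕ j)) ∧₁ ¬₁ below (toℕ j)
  isD j = pivot (below (toℕ j))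

  -- Only `d last` and `e` see every `c j`, as each `L i` misses its mark. Left vertices are those
  -- that see `c zero`, and among right vertices only the `R₀` miss `e`.
  isE nearE isLeft isR₀ isR₁ : Unary
  isE    = every (on-second (below N) ⇒₂ adjacent) ∧₁ ¬₁ isD last
  nearE  = neighbour isE
  isLeft = neighbour (below 1)
  isR₀   = ¬₁ isLeft ∧₁ ¬₁ nearE
  isR₁   = ¬₁ below N ∧₁ nearE

  -- The neighbour of kind `R₀` excludes the `d i`, some of which also miss the marked vertex.
  isL : Fin (suc m) → Unary
  isL i = neighbour isR₀ ∧₁ some (on-second (isC (mark i)) ∧₂ ¬₂ adjacent)

  point : Extra → Unary
  point (c j) = isC j
  point (d j) = isD j
  point e     = isE

  copy : Place → Binary
  copy R₀    = equal
  copy R₁    = on-first isR₁ ∧₂ (adjacent ⨾ (on-first (isL zero) ∧₂ adjacent))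
  copy (L i) = on-first (isL i) ∧₂ adjacent

  atom : Fin m → Binary
  atom R = (adjacent ∧₂ on-second (isL (suc R))) ⨾ (adjacent ⨾ copy R₁)

  -- Correctness of the defining formulas in the coded graph.

  module Correct (A : FiniteStructure m) where

    G : Graph
    G = graph A

    E : Vertex A → Vertex A → Set
    E u v = T (edge A u v)

    self : ∀ a → T ⌊ _≟ᶜ_ A a a ⌋
    self a = fromWitness refl

    a₀ : Carrier A
    a₀ = Inverse.from (enumeration A) (fromℕ< (nonempty A))

    ≤last : (i : Fin N) → i Fin.≤ last
    ≤last = Fin.≤fromℕ

    Below : ℕ → Vertex A → Set
    Below j v = ∃[ i ] (v ≡ inj₂ (c i) × toℕ i ℕ.< j)

    -- The goal is a negation, so `x ≡ z` and `y ≡ z` can be assumed in turn without deciding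
    -- equality of vertices.
    pivot-unique : ∀ P v {x y} → E v x → E v y → x ≢ y →
                   ¬ U.Holds P G x → ¬ U.Holds P G y → ¬ U.Holds (pivot P) G v
    pivot-unique P v Evx Evy x≢y ¬Px ¬Py (z , _ , only) =
      only (_ , (Evx , ¬Px) , λ x≡z → only (_ , (Evy , ¬Py) , λ y≡z → x≢y (trans x≡z (sym y≡z))))

    d-neighbour : ∀ i v → E (inj₂ (d i)) v → ∃[ l ] (v ≡ inj₂ (c l) × l Fin.≤ i)
    d-neighbour i (inj₂ (c l))     E-il = l , refl , toWitness E-il
    d-neighbour i (inj₁ (_ , R₀))  ()
    d-neighbour i (inj₁ (_ , R₁))  ()
    d-neighbour i (inj₁ (_ , L _)) ()

    module _ (j : Fin N) (below-j : ∀ v → U.Holds (below (toℕ j)) G v ⇔ Below (toℕ j) v) where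

      not-c : ∀ {v} → (∀ i → v ≢ inj₂ (c i)) → ¬ U.Holds (below (toℕ j)) G v
      not-c v≢c h = let i , eq , _ = to (below-j _) h in v≢c i eq

      not-below : ∀ {i} → j Fin.≤ i → ¬ U.Holds (below (toℕ j)) G (inj₂ (c i))
      not-below j≤i h with to (below-j _) h
      ... | i , refl , i<j = ℕ.<⇒≱ i<j j≤i

      above : ∀ {i} → ¬ U.Holds (below (toℕ j)) G (inj₂ (c i)) → j Fin.≤ i
      above {i} ¬h = ℕ.≮⇒≥ λ i<j → ¬h (from (below-j _) (i , refl , i<j))

      two-outside : ∀ v {x y} → E v x → E v y → x ≢ y →
                    ¬ U.Holds (below (toℕ j)) G x → ¬ U.Holds (below (toℕ j)) G y → ¬ U.Holds (isD j) G v
      two-outside = pivot-unique (below (toℕ j))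

      -- A `d i` with `i < j` has no neighbour outside the set; every other vertex except `d j` has
      -- two.
      pivot⇒d : ∀ v → U.Holds (isD j) G v → v ≡ inj₂ (d j)
      pivot⇒d (inj₂ (d i)) h@(y , (E-iy , out) , _) with i Fin.≟ j | d-neighbour i y E-iy
      ... | yes refl | _ = refl
      -- An outside neighbour `c l` has `j ≤ l ≤ i`, so `c i` and `c j` are both outside neighbours.
      ... | no  i≢j  | l , refl , l≤i = ⊥-elim (two-outside (inj₂ (d i)) {inj₂ (c i)} {inj₂ (c j)}
        (fromWitness ℕ.≤-refl) (fromWitness j≤i) (λ { refl → i≢j refl }) (not-below j≤i) (not-below ℕ.≤-refl) h)
        where
        j≤i : j Fin.≤ i
        j≤i = ℕ.≤-trans (above out) l≤i
      pivot⇒d v@(inj₂ e) h = ⊥-elim (two-outside v {inj₂ (c last)} {inj₁ (a₀ , R₁)}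
        tt tt (λ ()) (not-below (≤last j)) (not-c λ _ ()) h)
      pivot⇒d v@(inj₂ (c i)) h = ⊥-elim (two-outside v {inj₂ e} {inj₂ (d last)}
        tt (fromWitness (≤last i)) (λ ()) (not-c λ _ ()) (not-c λ _ ()) h)
      -- `c last` is adjacent because `last` is never a mark.
      pivot⇒d v@(inj₁ (a , L i)) h = ⊥-elim (two-outside v {inj₂ (c last)} {inj₁ (a , R₀)}
        (fromWitness (last≢mark i)) (self a) (λ ()) (not-below (≤last j)) (not-c λ _ ()) h)
      -- Two different copies `L` exist because `m` is positive: one for equality and one for the
      -- first relation symbol.
      pivot⇒d v@(inj₁ (a , R₀)) h = ⊥-elim (two-outside v {inj₁ (a , L zero)} {inj₁ (a , L (suc zero))}
        (self a) (self a) (λ ()) (not-c λ _ ()) (not-c λ _ ()) h)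
      pivot⇒d v@(inj₁ (a , R₁)) h = ⊥-elim (two-outside v {inj₂ e} {inj₁ (a , L zero)}
        tt (self a) (λ ()) (not-c λ _ ()) (not-c λ _ ()) h)

      d⇒pivot : U.Holds (isD j) G (inj₂ (d j))
      d⇒pivot = inj₂ (c j) , (fromWitness ℕ.≤-refl , not-below ℕ.≤-refl) , only
        where
        only : ¬ (∃[ z ] ((E (inj₂ (d j)) z × ¬ U.Holds (below (toℕ j)) G z) × z ≢ inj₂ (c j)))
        only (z , (E-jz , out) , z≢c) with d-neighbour j z E-jz
        ... | l , refl , l≤j = z≢c (cong (λ i → inj₂ (c i)) (Fin.≤-antisym l≤j (above out)))

      pivot-correct : ∀ v → U.Holds (isD j) G v ⇔ v ≡ inj₂ (d j)
      pivot-correct v = mk⇔ (pivot⇒d v) λ { refl → d⇒pivot }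

    neighbour-d : ∀ j v → E v (inj₂ (d j)) → Below (suc (toℕ j)) v
    neighbour-d j v Evd with d-neighbour j v (edge-symmetric A v (inj₂ (d j)) Evd)
    ... | i , eq , i≤j = i , eq , s≤s i≤j

    -- Induction along the half graph: the set below `j` isolates `d j` as its pivot, and the
    -- neighbours of `d j` are the `c i` with `i ≤ j`.
    below-correct : ∀ {j} → j ℕ.≤ N → ∀ v → U.Holds (below j) G v ⇔ Below j v
    below-correct {zero}  _   v = mk⇔ (λ ()) (λ ())
    below-correct {suc j} j<N v = mk⇔
      (λ { (w , Evw , h) → subst (λ l → Below (suc l) v) (Fin.toℕ-fromℕ< j<N)
             (neighbour-d f v (subst (E v) (to (pivot-f w) h) Evw)) })
      (λ { (i , refl , s≤s i≤j) → inj₂ (d f)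
         , fromWitness (subst (toℕ i ℕ.≤_) (sym (Fin.toℕ-fromℕ< j<N)) i≤j) , from (pivot-f _) refl })
      where
      f : Fin N
      f = fromℕ< j<N

      -- The transports replace `j` by `toℕ f`, the form in which `pivot-correct` is stated.
      pivot-f : ∀ w → U.Holds (pivot (below j)) G w ⇔ w ≡ inj₂ (d f)
      pivot-f = subst (λ l → ∀ w → U.Holds (pivot (below l)) G w ⇔ w ≡ inj₂ (d f)) (Fin.toℕ-fromℕ< j<N)
        (pivot-correct f (subst (λ l → ∀ w → U.Holds (below l) G w ⇔ Below l w) (sym (Fin.toℕ-fromℕ< j<N))
          (below-correct (ℕ.<⇒≤ j<N))))

    isD-correct : ∀ j v → U.Holds (isD j) G v ⇔ v ≡ inj₂ (d j)
    isD-correct j = pivot-correct j (below-correct (ℕ.<⇒≤ (Fin.toℕ<n j)))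

    isC-correct : ∀ j v → U.Holds (isC j) G v ⇔ v ≡ inj₂ (c j)
    isC-correct j v = mk⇔ forward backward
      where
      j<N : toℕ j ℕ.< N
      j<N = Fin.toℕ<n j

      forward : U.Holds (isC j) G v → v ≡ inj₂ (c j)
      forward (h , ¬h) with to (below-correct j<N v) h
      ... | i , refl , s≤s i≤j = cong (λ i → inj₂ (c i)) (Fin.≤-antisym i≤j
        (ℕ.≮⇒≥ λ i<j → ¬h (from (below-correct (ℕ.<⇒≤ j<N) v) (i , refl , i<j))))

      backward : v ≡ inj₂ (c j) → U.Holds (isC j) G v
      backward refl = from (below-correct j<N v) (j , refl , ℕ.≤-refl)
             , λ h → case-below (to (below-correct (ℕ.<⇒≤ j<N) v) h)
        where
        case-below : ¬ Below (toℕ j) (inj₂ (c j))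
        case-below (_ , refl , j<j) = ℕ.<-irrefl refl j<j

    below-all : ∀ i → U.Holds (below N) G (inj₂ (c i))
    below-all i = from (below-correct ℕ.≤-refl _) (i , refl , Fin.toℕ<n i)

    isE-correct : ∀ v → U.Holds isE G v ⇔ v ≡ inj₂ e
    isE-correct v = mk⇔ (forward v) λ { refl → all-c , (λ h → e≢d (to (isD-correct last _) h)) }
      where
      e≢d : ¬ _≡_ {A = Vertex A} (inj₂ e) (inj₂ (d last))
      e≢d ()

      all-c : ∀ w → U.Holds (below N) G w → E (inj₂ e) w
      all-c w h with to (below-correct ℕ.≤-refl w) h
      ... | i , refl , _ = tt

      forward : ∀ v → U.Holds isE G v → v ≡ inj₂ e
      forward (inj₂ e) _ = refl
      forward (inj₂ (c i)) (h , _) = ⊥-elim (h (inj₂ (c zero)) (below-all zero))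
      -- Seeing `c last` forces `i` to be `last`, which `isE` excludes.
      forward (inj₂ (d i)) (h , ¬d) = ⊥-elim (¬d (from (isD-correct last _) (cong (λ i → inj₂ (d i))
        (Fin.≤-antisym (≤last i) (toWitness (h (inj₂ (c last)) (below-all last)))))))
      forward (inj₁ (a , L i)) (h , _) = ⊥-elim (toWitness (h (inj₂ (c (mark i))) (below-all (mark i))) refl)
      forward (inj₁ (a , R₀)) (h , _) = ⊥-elim (h (inj₂ (c zero)) (below-all zero))
      forward (inj₁ (a , R₁)) (h , _) = ⊥-elim (h (inj₂ (c zero)) (below-all zero))

    nearE-correct : ∀ v → U.Holds nearE G v ⇔ E v (inj₂ e)
    nearE-correct v = mk⇔ (λ (w , Evw , h) → subst (E v) (to (isE-correct w) h) Evw)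
                          (λ Eve → inj₂ e , Eve , from (isE-correct _) refl)

    isLeft-correct : ∀ v → U.Holds isLeft G v ⇔ T (left A v)
    isLeft-correct v = mk⇔ forward (λ l → inj₂ (c zero) , backward v l , from (below-1 _) (zero , refl , s≤s z≤n))
      where
      below-1 : ∀ w → U.Holds (below 1) G w ⇔ Below 1 w
      below-1 = below-correct (s≤s z≤n)

      right-c : ∀ v → E v (inj₂ (c zero)) → T (left A v)
      right-c (inj₁ (_ , L _)) _ = tt
      right-c (inj₂ (d _))     _ = tt
      right-c (inj₂ e)         _ = tt

      forward : U.Holds isLeft G v → T (left A v)
      forward (w , Evw , h) with to (below-1 w) h
      ... | zero , refl , _ = right-c v Evw
      ... | suc _ , _ , s≤s ()

      backward : ∀ v → T (left A v) → E v (inj₂ (c zero))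
      backward (inj₁ (_ , L i)) _ = tt
      backward (inj₂ (d _))     _ = tt
      backward (inj₂ e)         _ = tt

    isR₁-correct : ∀ v → U.Holds isR₁ G v ⇔ (∃[ a ] v ≡ inj₁ (a , R₁))
    isR₁-correct v = mk⇔ (λ (¬c , near) → forward v ¬c (to (nearE-correct v) near))
      λ { (a , refl) → (λ h → case-below (to (below-correct ℕ.≤-refl _) h)) , from (nearE-correct v) tt }
      where
      case-below : ∀ {a} → ¬ Below N (inj₁ (a , R₁))
      case-below (_ , () , _)

      forward : ∀ v → ¬ U.Holds (below N) G v → E v (inj₂ e) → ∃[ a ] v ≡ inj₁ (a , R₁)
      forward (inj₁ (a , R₁)) _  _ = a , refl
      forward (inj₂ (c i))    ¬c _ = ⊥-elim (¬c (below-all i))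

    isR₀-correct : ∀ v → U.Holds isR₀ G v ⇔ (∃[ a ] v ≡ inj₁ (a , R₀))
    isR₀-correct v = mk⇔
      (λ (¬l , ¬n) → forward v (λ l → ¬l (from (isLeft-correct v) l)) (λ n → ¬n (from (nearE-correct v) n)))
      λ { (a , refl) → (λ l → to (isLeft-correct v) l) , (λ n → to (nearE-correct v) n) }
      where
      forward : ∀ v → ¬ T (left A v) → ¬ E v (inj₂ e) → ∃[ a ] v ≡ inj₁ (a , R₀)
      forward (inj₁ (a , R₀))  _ _ = a , refl
      forward (inj₁ (a , R₁))  _ ¬n = ⊥-elim (¬n tt)
      forward (inj₁ (a , L i)) ¬l _ = ⊥-elim (¬l tt)
      forward (inj₂ (c i))     _ ¬n = ⊥-elim (¬n tt)
      forward (inj₂ (d i))     ¬l _ = ⊥-elim (¬l tt)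
      forward (inj₂ e)         ¬l _ = ⊥-elim (¬l tt)

    isL-correct : ∀ i v → U.Holds (isL i) G v ⇔ (∃[ a ] v ≡ inj₁ (a , L i))
    isL-correct i v = mk⇔ forward
      λ { (a , refl) → (inj₁ (a , R₀) , self a , from (isR₀-correct _) (a , refl))
                     , inj₂ (c (mark i)) , from (isC-correct (mark i) _) refl , λ h → toWitness h refl }
      where
      misses-mark : ∀ v b → E v (inj₁ (b , R₀)) → ¬ E v (inj₂ (c (mark i))) → ∃[ a ] v ≡ inj₁ (a , L i)
      misses-mark (inj₁ (a , L i′)) b _ ¬m with mark i Fin.≟ mark i′
      ... | yes eq = a , cong (λ i → inj₁ (a , L i)) (sym (mark-injective eq))
      ... | no  neq = ⊥-elim (¬m tt)
      misses-mark (inj₂ (c _)) b ()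
      misses-mark (inj₂ (d _)) b ()
      misses-mark (inj₂ e)     b ()

      forward : U.Holds (isL i) G v → ∃[ a ] v ≡ inj₁ (a , L i)
      forward ((w , Evw , hw) , (z , hz , ¬Evz)) with to (isR₀-correct w) hw | to (isC-correct (mark i) z) hz
      ... | b , refl | refl = misses-mark v b Evw ¬Evz

    point-correct : ∀ j v → U.Holds (point j) G v ⇔ v ≡ inj₂ j
    point-correct (c j) = isC-correct j
    point-correct (d j) = isD-correct j
    point-correct e     = isE-correct

    copy-correct : ∀ t v a → B.Holds (copy t) G v (inj₁ (a , R₀)) ⇔ v ≡ inj₁ (a , t)
    copy-correct R₀ v a = mk⇔ (λ eq → eq) (λ eq → eq)
    copy-correct (L i) v a = mk⇔ forward λ { refl → from (isL-correct i v) (a , refl) , self a }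
      where
      forward : B.Holds (copy (L i)) G v (inj₁ (a , R₀)) → v ≡ inj₁ (a , L i)
      forward (l , E-va) with to (isL-correct i v) l
      ... | b , refl = cong (λ b → inj₁ (b , L i)) (toWitness E-va)
    copy-correct R₁ v a = mk⇔ forward
      λ { refl → from (isR₁-correct v) (a , refl)
               , inj₁ (a , L zero) , self a , from (isL-correct zero _) (a , refl) , self a }
      where
      forward : B.Holds (copy R₁) G v (inj₁ (a , R₀)) → v ≡ inj₁ (a , R₁)
      forward (r , w , E-vw , l , E-wa) with to (isR₁-correct v) r | to (isL-correct zero w) l
      ... | b , refl | b′ , refl = cong (λ b → inj₁ (b , R₁)) (trans (sym (toWitness E-vw)) (toWitness E-wa))

    -- The first edge ties the `L` vertex to `a`, the copy relation ties the `R₁` vertex to `b`, and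
    -- the edge between them is `R a b` itself.
    atom-correct : ∀ R a b → B.Holds (atom R) G (inj₁ (a , R₀)) (inj₁ (b , R₀)) ⇔ T (interp A R a b)
    atom-correct R a b = mk⇔ forward
      λ t → inj₁ (a , L (suc R)) , (self a , from (isL-correct (suc R) _) (a , refl))
          , inj₁ (b , R₁) , t , from (copy-correct R₁ _ b) refl
      where
      forward : B.Holds (atom R) G (inj₁ (a , R₀)) (inj₁ (b , R₀)) → T (interp A R a b)
      forward (w , (E-aw , l) , z , E-wz , r) with to (isL-correct (suc R) w) l | to (copy-correct R₁ z b) r
      ... | a′ , refl | refl = subst (λ a → T (interp A R a b)) (toWitness E-aw) E-wz

    crosses : ∀ u v → E u v →
              (U.Holds isLeft G u × ¬ U.Holds isLeft G v) ⊎ (¬ U.Holds isLeft G u × U.Holds isLeft G v)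
    crosses u v Euv with edge-crosses A u v Euv
    ... | inj₁ (lu , ¬lv) = inj₁ (from (isLeft-correct u) lu , ¬lv ∘ to (isLeft-correct v))
    ... | inj₂ (¬lu , lv) = inj₂ (¬lu ∘ to (isLeft-correct u) , from (isLeft-correct v) lv)

  interpretation : Interpretation k₀ m
  interpretation = record
    { layout         = layout
    ; base           = R₀
    ; domain         = isR₀
    ; side           = isLeft
    ; copy           = copy
    ; point          = point
    ; atom           = atom
    ; domain-correct = Correct.isR₀-correct
    ; copy-correct   = Correct.copy-correct
    ; point-correct  = Correct.point-correct
    ; atom-correct   = Correct.atom-correct
    ; edge-symmetric = edge-symmetric
    ; edge-crosses   = Correct.crosses
    }

theorem1p1 : (k m : ℕ) → k ℕ.≥ 3 → m ℕ.≥ 1 → (Φ : Sentence m k) →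
    Σ[ Φ' ∈ Sentence 1 k ] Σ[ p ∈ ℤ ] Σ[ q ∈ ℤ ]
    ( p ≥ 1ℤ
    × Image +_ (Spec Φ') ≐ Image (λ n → p * + n + q) (Spec Φ)
    × ((M : FiniteStructure 1) → M ⊨ Φ' → IsUndirectedBipartite M) )
-- Matching on the bounds writes `k` as `3 + k₀` and `m` as `1 + m₀`.
theorem1p1 _ _ (s≤s (s≤s (s≤s {n = k₀} z≤n))) (s≤s {n = m₀} z≤n) Φ =
  spectrum-image k₀ (suc m₀) (GraphOf.interpretation k₀ m₀) Φ
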